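{- Let $m,n$ be positive integers with $m<n$ and $m$ even, and let $G$ be a connected finite simple graph with maximum degree $\Delta(G)\ge 4$. Then $\chi(G^{\frac{m}{n}})=\omega(G^{\frac{m}{n}})$.
   Context: For a graph $G$ and positive integer $n$, the $n$-subdivision $G^{\frac{1}{n}}$ is obtained from $G$ by replacing each edge with a path of length $n$. For a graph $H$ and positive integer $m$, the $m$-th power $H^m$ is the graph on $V(H)$ in which two distinct vertices are adjacent iff their distance in $H$ is at most $m$. The fractional power is $G^{\frac{m}{n}}=(G^{\frac{1}{n}})^m$. $\chi$ denotes the chromatic number and $\omega$ the clique number. -}

module Defs where

open import Data.Nat using (ℕ; zero; suc; _+_; _≤_; _<_; _>_; _⊔_; s≤s; z≤n; _<?_)
open import Data.Fin using (Fin)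
open import Data.Bool using (Bool; true; false; if_then_else_)
open import Data.List using (List; map; foldr; allFin)
open import Data.Nat.ListAction using (sum)
open import Data.Product using (Σ; ∃; _×_; _,_; proj₁; proj₂)
open import Data.Sum using (_⊎_; inj₁; inj₂)
open import Relation.Binary.PropositionalEquality using (_≡_; _≢_)
open import Relation.Nullary using (¬_; yes; no)

data Walk {V : Set} (R : V → V → Set) : V → V → ℕ → Set where
  nil  : ∀ {x} → Walk R x x 0
  cons : ∀ {x y z ℓ} → R x y → Walk R y z ℓ → Walk R x z (suc ℓ)

Power : {V : Set} → (V → V → Set) → ℕ → V → V → Set
Power R m x y = x ≢ y × Σ ℕ (λ ℓ → ℓ ≤ m × Walk R x y ℓ)

Colourable : {V : Set} → (V → V → Set) → ℕ → Set
Colourable {V} R k = Σ (V → Fin k) (λ c → ∀ x y → R x y → c x ≢ c y)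

IsChromaticNumber : {V : Set} → (V → V → Set) → ℕ → Set
IsChromaticNumber R k = Colourable R k × (∀ j → j < k → ¬ Colourable R j)

-- clique of size k (pairwise adjacent, hence injective, family of k vertices)
HasClique : {V : Set} → (V → V → Set) → ℕ → Set
HasClique {V} R k = Σ (Fin k → V) (λ f → ∀ i j → i ≢ j → R (f i) (f j))

IsCliqueNumber : {V : Set} → (V → V → Set) → ℕ → Set
IsCliqueNumber R k = HasClique R k × (∀ j → j > k → ¬ HasClique R j)

record FinGraph : Set where
  field
    N     : ℕ
    adj   : Fin N → Fin N → Bool
    sym   : ∀ u v → adj u v ≡ adj v u
    irrefl : ∀ v → adj v v ≡ false

module _ (G : FinGraph) where
  open FinGraph G

  Adj : Fin N → Fin N → Set
  Adj u v = adj u v ≡ true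

  Connected : Set
  Connected = ∀ u v → Σ ℕ (λ ℓ → Walk Adj u v ℓ)

  degree : Fin N → ℕ
  degree v = sum (map (λ w → if adj v w then 1 else 0) (allFin N))

  maxDegree : ℕ
  maxDegree = foldr _⊔_ 0 (map degree (allFin N))

  -- edges, each listed once as (u , v) with u < v
  Edge : Set
  Edge = Σ (Fin N) (λ u → Σ (Fin N) (λ v → (Data.Fin._<_ u v) × Adj u v))

  -- vertices of the n-subdivision: original vertices, plus for each edge
  -- the internal path vertices at positions j with 0 < j < n
  SubV : ℕ → Set
  SubV n = Fin N ⊎ Σ Edge (λ e → Σ ℕ (λ j → 0 < j × j < n))

  -- the vertex at position j on the path replacing edge e = (u,v):
  -- position 0 is u, position n is v
  at : (n : ℕ) → Edge → ℕ → SubV n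
  at n e zero = inj₁ (proj₁ e)
  at n e (suc j) with suc j <? n
  ... | yes p = inj₂ (e , suc j , s≤s z≤n , p)
  ... | no _  = inj₁ (proj₁ (proj₂ e))

  SubAdj : (n : ℕ) → SubV n → SubV n → Set
  SubAdj n x y = Σ Edge (λ e → Σ ℕ (λ j → j < n ×
    ((x ≡ at n e j × y ≡ at n e (suc j)) ⊎ (y ≡ at n e j × x ≡ at n e (suc j)))))

  FracPowAdj : (m n : ℕ) → SubV n → SubV n → Set
  FracPowAdj m n = Power (SubAdj n) m

{-# OPTIONS --safe #-}

-- Write m = 2k, L = 2k + 1 ≤ n and Δ for the maximum degree. The ball of radius k around a vertex of
-- degree Δ is a clique of size 1 + Δk, so it suffices to colour with 1 + Δk colours: a blank one and
-- pairs (a , i) of a hue a < Δ and a level 1 ≤ i ≤ k. Every original vertex is blank. The darts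
-- (u , w) receive hues that are distinct around each vertex and differ on the two darts of an edge,
-- and the point at distance i ≤ k from u on the path of (u , w) is coloured (hue , i). The middle of a
-- path uses its own two hues and two further ones (hence Δ ≥ 4), in such a way that equal colours on
-- the path are at least L apart and a point at distance t > k from an end has level at least L − t.
-- A walk of length at most 2k < n either stays on one path or turns at a single original vertex;
-- these two properties exclude equal colours in the respective cases.
--
-- The hues are found by inserting the edges of G one at a time, with a Kempe exchange whenever the
-- only hue missing at both ends is the same.

module Submission where

open import Defs
open import Axiom.UniquenessOfIdentityProofs using (module Decidable⇒UIP)
open import Data.Bool using (Bool; true; false; if_then_else_)
import Data.Bool.Properties as Bool
open import Data.Fin using (Fin; zero; suc)
import Data.Fin as Fin
open import Data.Fin.Permutation.Components using (transpose; transpose-inverse)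
import Data.Fin.Properties as Fin
open import Data.Fin.Subset using (Subset; _∈_; _∉_; _⊃_; _∪_; ⁅_⁆)
open import Data.Fin.Subset.Induction using (⊃-wellFounded)
open import Data.Fin.Subset.Properties using (_∈?_; x∈⁅x⁆; x∈⁅y⁆⇒x≡y; p⊆p∪q; q⊆p∪q; x∈p∪q⁻)
open import Data.List using (List; []; _∷_; length; map; filter; foldr; allFin; lookup; cartesianProduct)
import Data.List.Membership.DecPropositional as DecMembership
import Data.List.Membership.Propositional as List
open import Data.List.Membership.Propositional.Properties using (∈-map⁺; ∈-map⁻; ∈-filter⁺; ∈-filter⁻; ∈-allFin; ∈-lookup; ∈-cartesianProduct⁺; foldr-selective)
import Data.List.Membership.Setoid.Properties as Setoid
open import Data.List.Properties using (length-map; filter-notAll)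
import Data.List.Relation.Unary.All as All
open import Data.List.Relation.Unary.AllPairs using (_∷_)
open import Data.List.Relation.Unary.Any using (here; there; index)
import Data.List.Relation.Unary.Any as Any
open import Data.List.Relation.Unary.Unique.Propositional using (Unique)
import Data.List.Relation.Unary.Unique.Propositional.Properties as Unique
open import Data.Maybe using (Maybe; just; nothing)
import Data.Maybe as Maybe
open import Data.Maybe.Properties using (just-injective)
open import Data.Nat using (ℕ; zero; suc; _+_; _*_; _∸_; _⊔_; _≤_; _<_; z≤n; s≤s; _≤?_; _<?_)
open import Data.Nat.Divisibility using (_∣_; divides)
open import Data.Nat.Induction using (<-wellFounded)
open import Data.Nat.ListAction using (sum)
open import Data.Nat.Properties hiding (_≤?_; _<?_)
open import Data.Product using (Σ; ∃; ∃₂; _×_; _,_; proj₁; proj₂)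
import Data.Product as Product
open import Data.Product.Properties using (≡-dec)
open import Data.Sum using (_⊎_; inj₁; inj₂)
open import Function using (_∘_)
open import Induction.WellFounded using (Acc; acc)
open import Relation.Binary.Definitions using (tri<; tri≈; tri>)
open import Relation.Binary.PropositionalEquality using (_≡_; _≢_; refl; sym; trans; cong; cong₂; subst; setoid; module ≡-Reasoning)
open import Relation.Nullary using (¬_; Dec; yes; no; contradiction)
open import Relation.Nullary.Decidable using (¬?; _×-dec_; _⊎-dec_; decidable-stable)

-- Colour patterns on a path

Symbol : Set → Set
Symbol A = Maybe (A × ℕ)

-- A and B are the hues of the two darts of an edge, C and D two further hues.
data Letter : Set where
  A B C D : Letter

module Word (k : ℕ) where

  L : ℕ
  L = suc (k + k)

  -- What an end of a path with hue `a` prescribes at distance `p`: exactly `(a , p)` up to distance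
  -- `k`, and beyond it any hue with a level of at least `L - p`.
  data Near {X : Set} (a : X) : ℕ → Symbol X → Set where
    end  : Near a 0 nothing
    near : ∀ {p} → 1 ≤ p → p ≤ k → Near a p (just (a , p))
    far  : ∀ {p c i} → k < p → L ≤ p + i → Near a p (just (c , i))

  data Valid {X : Set} : Symbol X → Set where
    blank : Valid nothing
    level : ∀ {a i} → 1 ≤ i → i ≤ k → Valid (just (a , i))

  -- `window` handles walks along one path, `left` and `right` walks that turn at one of its ends. A
  -- variable `s` with `t + s ≡ n` avoids truncated subtraction.
  record Pattern (n : ℕ) : Set where
    field
      σ      : ℕ → Symbol Letter
      left   : ∀ {t} → t < L → Near A t (σ t)
      right  : ∀ {t s} → t + s ≡ n → s < L → Near B s (σ t)
      valid  : ∀ {t s} → t + s ≡ n → Valid (σ t)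
      window : ∀ {t u} → t < u → u ≤ n → σ t ≡ σ u → L + t ≤ u

  complement-bounds : ∀ {i t} → i + t ≡ L → k < t → t < L → 1 ≤ i × i ≤ k
  complement-bounds {zero}  refl _ t<L = contradiction t<L (n≮n _)
  complement-bounds {suc i} {t} e k<t _ = s≤s z≤n , +-cancelʳ-≤ t _ _ (begin
    suc i + t   ≡⟨ e ⟩
    suc (k + k) ≡⟨ sym (+-suc k k) ⟩
    k + suc k   ≤⟨ +-monoʳ-≤ k k<t ⟩
    k + t       ∎)
    where open ≤-Reasoning

  complement : ∀ {t} → t < L → ∃ λ i → i + t ≡ L
  complement {t} t<L = L ∸ t , m∸n+n≡m (<⇒≤ t<L)

  -- The word A₁ … Aₖ, C…, D…, Bₖ … B₁ between two blanks, with C on the first half of the gap and D on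
  -- the second; t and s are the distances from the two ends.
  data Last : ℕ → ℕ → Symbol Letter → Set where
    startO : ∀ {s} → Last 0 s nothing
    endO   : ∀ {t} → Last t 0 nothing
    inA    : ∀ {t s} → 1 ≤ t → t ≤ k → Last t s (just (A , t))
    inB    : ∀ {t s} → 1 ≤ s → s ≤ k → Last t s (just (B , s))
    inC    : ∀ {t s i} → k < t → t ≤ s → i + t ≡ L → Last t s (just (C , i))
    inD    : ∀ {t s i} → k < s → s < t → i + s ≡ L → Last t s (just (D , i))

  module _ {n : ℕ} (L≤n : L ≤ n) (n<2L : n < L + L) where

    -- `C` and `D` carry the level `L` minus the distance to the nearer end. It is positive because
    -- two distances of at least `L` would sum to more than `n`.
    smaller-half : ∀ {t s} → t + s ≤ n → t ≤ s → t < L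
    smaller-half {t} {s} e t≤s with t <? L
    ... | yes t<L = t<L
    ... | no t≮L = contradiction n<2L (≤⇒≯ (≤-trans (+-mono-≤ (≮⇒≥ t≮L) (≤-trans (≮⇒≥ t≮L) t≤s)) e))

    last : ∀ t s → t + s ≤ n → ∃ (Last t s)
    last zero s e = _ , startO
    last (suc t) zero e = _ , endO
    last t@(suc _) s@(suc _) e with t ≤? k | s ≤? k | t ≤? s
    ... | yes t≤k | _ | _ = _ , inA (s≤s z≤n) t≤k
    ... | no _ | yes s≤k | _ = _ , inB (s≤s z≤n) s≤k
    ... | no t≰k | no _ | yes t≤s = _ , inC (≰⇒> t≰k) t≤s (proj₂ (complement (smaller-half e t≤s)))
    ... | no _ | no s≰k | no t≰s = _ , inD (≰⇒> s≰k) (≰⇒> t≰s)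
      (proj₂ (complement (smaller-half (≤-trans (≤-reflexive (+-comm s t)) e) (<⇒≤ (≰⇒> t≰s)))))

    both-short : ∀ {t s} {X : Set} → t + s ≡ n → t ≤ k → s ≤ k → X
    both-short refl t≤k s≤k = contradiction (+-mono-≤ t≤k s≤k) (<⇒≱ L≤n)

    -- The stretches beyond `A` meet the `far` bound: `B` since `t + s ≡ n` is at least `L`, `C`
    -- with equality, `D` since its level is `L - s` and `s < t`.
    last-left : ∀ {t s x} → t + s ≡ n → t < L → Last t s x → Near A t x
    last-left e t<L startO = end
    last-left {t} e t<L endO = contradiction (≤-trans L≤n (≤-reflexive (trans (sym e) (+-identityʳ t)))) (<⇒≱ t<L)
    last-left e t<L (inA p q) = near p q
    last-left {t} {s} e t<L (inB p q) with t ≤? k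
    ... | yes t≤k = both-short e t≤k q
    ... | no t≰k = far (≰⇒> t≰k) (≤-trans L≤n (≤-reflexive (sym e)))
    last-left {t} e t<L (inC {i = i} p q r) = far p (≤-reflexive (trans (sym r) (+-comm i t)))
    last-left {t} e t<L (inD {s = s} {i} p q r) =
      far (<-trans p q) (≤-trans (≤-reflexive (trans (sym r) (+-comm i s))) (+-monoˡ-≤ i (<⇒≤ q)))

    last-right : ∀ {t s x} → t + s ≡ n → s < L → Last t s x → Near B s x
    last-right e s<L startO = contradiction (≤-trans L≤n (≤-reflexive (sym e))) (<⇒≱ s<L)
    last-right e s<L endO = end
    last-right {t} {s} e s<L (inA p q) with s ≤? k
    ... | yes s≤k = both-short e q s≤k
    ... | no s≰k = far (≰⇒> s≰k) (≤-trans L≤n (≤-reflexive (trans (sym e) (+-comm t s))))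
    last-right e s<L (inB p q) = near p q
    last-right {t} e s<L (inC {s = s} {i} p q r) =
      far (<-≤-trans p q) (≤-trans (≤-reflexive (trans (sym r) (+-comm i t))) (+-monoˡ-≤ i q))
    last-right e s<L (inD {s = s} {i} p q r) = far p (≤-reflexive (trans (sym r) (+-comm i s)))

    last-valid : ∀ {t s x} → t + s ≡ n → Last t s x → Valid x
    last-valid e startO = blank
    last-valid e endO = blank
    last-valid e (inA p q) = level p q
    last-valid e (inB p q) = level p q
    last-valid e (inC {i = i} p q r)
      with 1≤i , i≤k ← complement-bounds {i} r p (smaller-half (≤-reflexive e) q) = level 1≤i i≤k
    last-valid {t} e (inD {s = s} {i} p q r)
      with 1≤i , i≤k ← complement-bounds {i} r p
             (smaller-half (≤-reflexive (trans (+-comm s t) e)) (<⇒≤ q)) = level 1≤i i≤k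

    -- Each letter fills one stretch, along which the level determines the position. Only the two
    -- terminal blanks coincide; the last two alternatives are these.
    last-injective : ∀ {t s u v x} → t + s ≡ n → u + v ≡ n → Last t s x → Last u v x →
                     t ≡ u ⊎ (t ≡ 0 × v ≡ 0) ⊎ (s ≡ 0 × u ≡ 0)
    last-injective e f startO startO = inj₁ refl
    last-injective e f startO endO = inj₂ (inj₁ (refl , refl))
    last-injective e f endO startO = inj₂ (inj₂ (refl , refl))
    last-injective e f endO endO = inj₁ (+-cancelʳ-≡ 0 _ _ (trans e (sym f)))
    last-injective e f (inA _ _) (inA _ _) = inj₁ refl
    last-injective {s = s} e f (inB _ _) (inB _ _) = inj₁ (+-cancelʳ-≡ s _ _ (trans e (sym f)))
    last-injective e f (inC {i = i} _ _ p) (inC _ _ q) = inj₁ (+-cancelˡ-≡ i _ _ (trans p (sym q)))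
    last-injective e f (inD {i = i} _ _ p) (inD _ _ q)
      with refl ← +-cancelˡ-≡ i _ _ (trans p (sym q)) = inj₁ (+-cancelʳ-≡ _ _ _ (trans e (sym f)))

    private
      σ₀ : ℕ → Symbol Letter
      σ₀ t with t ≤? n
      ... | yes t≤n = proj₁ (last t (n ∸ t) (≤-reflexive (m+[n∸m]≡n t≤n)))
      -- A default past the end of the path; the fields of `Pattern` speak only of positions up to
      -- `n`.
      ... | no _ = nothing

      σ₀-last : ∀ {t s} → t + s ≡ n → Last t s (σ₀ t)
      σ₀-last {t} {s} refl with t ≤? t + s
      ... | no t≰ = contradiction (m≤m+n t s) t≰
      ... | yes t≤ = subst (λ z → Last t z (proj₁ w)) (m+n∸m≡n t s) (proj₂ w)
        where w = last t (t + s ∸ t) (≤-reflexive (m+[n∸m]≡n t≤))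

    shortPattern : Pattern n
    shortPattern = record
      { σ      = σ₀
      ; left   = λ t<L → let e = m+[n∸m]≡n (≤-trans (<⇒≤ t<L) L≤n) in last-left e t<L (σ₀-last e)
      ; right  = λ e s<L → last-right e s<L (σ₀-last e)
      ; valid  = λ {t} {s} e → last-valid {t} {s} e (σ₀-last e)
      ; window = window
      }
      where
      window : ∀ {t u} → t < u → u ≤ n → σ₀ t ≡ σ₀ u → L + t ≤ u
      window {t} {u} t<u u≤n eq
        with e ← m+[n∸m]≡n (≤-trans (<⇒≤ t<u) u≤n) | f ← m+[n∸m]≡n u≤n
        with last-injective {t} {n ∸ t} {u} {n ∸ u} e f (σ₀-last e) (subst (Last u (n ∸ u)) (sym eq) (σ₀-last f))
      ... | inj₁ refl = contradiction t<u (n≮n _)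
      ... | inj₂ (inj₁ (refl , n∸u≡0)) =
        ≤-trans (≤-reflexive (+-identityʳ L)) (≤-trans L≤n (m∸n≡0⇒m≤n n∸u≡0))
      ... | inj₂ (inj₂ (_ , refl)) = contradiction t<u λ ()

  -- Blank, A₁ … Aₖ, Bₖ … B₁: a stretch of length L, prepended to lengthen a pattern by L.
  data Block : ℕ → Symbol Letter → Set where
    startO : Block 0 nothing
    inA    : ∀ {t} → 1 ≤ t → t ≤ k → Block t (just (A , t))
    inB    : ∀ {t i} → k < t → i + t ≡ L → Block t (just (B , i))

  block : ∀ t → t < L → ∃ (Block t)
  block zero t<L = _ , startO
  block t@(suc _) t<L with t ≤? k
  ... | yes t≤k = _ , inA (s≤s z≤n) t≤k
  ... | no t≰k = _ , inB (≰⇒> t≰k) (proj₂ (complement t<L))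

  block-left : ∀ {t x} → Block t x → Near A t x
  block-left startO = end
  block-left (inA p q) = near p q
  block-left {t} (inB {i = i} p r) = far p (≤-reflexive (trans (sym r) (+-comm i t)))

  block-valid : ∀ {t x} → t < L → Block t x → Valid x
  block-valid t<L startO = blank
  block-valid t<L (inA p q) = level p q
  block-valid t<L (inB {i = i} p r) with 1≤i , i≤k ← complement-bounds {i} r p t<L = level 1≤i i≤k

  -- The block shows each symbol at the earliest place allowed from the left end: an `A` of level
  -- `t` sits at `t` or beyond `k`, a `B` of level `i` not before `L - i`.
  block-first : ∀ {t u x} → Block t x → Near A u x → t ≤ u
  block-first startO _ = z≤n
  block-first (inA _ _) (near _ _) = ≤-refl
  block-first (inA _ t≤k) (far k<u _) = ≤-trans t≤k (<⇒≤ k<u)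
  block-first {t} {u} (inB {i = i} _ r) (far _ q) =
    +-cancelʳ-≤ i t u (≤-trans (≤-reflexive (trans (+-comm t i) r)) q)

  block-injective : ∀ {t u x} → Block t x → Block u x → t ≡ u
  block-injective b c = ≤-antisym (block-first b (block-left c)) (block-first c (block-left b))

  module _ {n : ℕ} (L≤n : L ≤ n) (P : Pattern n) where
    private
      module P = Pattern P

      σ₁ : ℕ → Symbol Letter
      σ₁ t with t <? L
      ... | yes t<L = proj₁ (block t t<L)
      ... | no _ = P.σ (t ∸ L)

      σ₁-block : ∀ {t} → t < L → Block t (σ₁ t)
      σ₁-block {t} t<L with t <? L
      ... | yes q = proj₂ (block t q)
      ... | no t≮L = contradiction t<L t≮L

      σ₁-shift : ∀ t → σ₁ (L + t) ≡ P.σ t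
      σ₁-shift t with L + t <? L
      ... | yes q = contradiction q (m+n≮m L t)
      ... | no _ = cong P.σ (m+n∸m≡n L t)

      data Split : ℕ → Set where
        early : ∀ {t} → t < L → Split t
        late  : ∀ t → Split (L + t)

      split : ∀ t → Split t
      split t with t <? L
      ... | yes t<L = early t<L
      ... | no t≮L = subst Split (m+[n∸m]≡n (≮⇒≥ t≮L)) (late (t ∸ L))

    -- A block followed by `P`. By `block-first`, a symbol at `t` in the block recurs in `P` only at
    -- its position `t` or later, which is `L + t` or later in the whole.
    longPattern : Pattern (L + n)
    longPattern = record
      { σ = σ₁ ; left = λ t<L → block-left (σ₁-block t<L) ; right = right ; valid = λ {t} {s} → valid {t} {s} ; window = window }
      where
      tail : ∀ t s → L + t + s ≡ L + n → t + s ≡ n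
      tail t s e = +-cancelˡ-≡ L _ _ (trans (sym (+-assoc L t s)) e)

      right : ∀ {t s} → t + s ≡ L + n → s < L → Near B s (σ₁ t)
      right {t} {s} e s<L with split t
      ... | early t<L = contradiction (+-mono-< t<L (<-≤-trans s<L L≤n)) (<-irrefl e)
      ... | late t = subst (Near B s) (sym (σ₁-shift t)) (P.right (tail t s e) s<L)

      valid : ∀ {t s} → t + s ≡ L + n → Valid (σ₁ t)
      valid {t} {s} e with split t
      ... | early t<L = block-valid t<L (σ₁-block t<L)
      ... | late t = subst Valid (sym (σ₁-shift t)) (P.valid (tail t s e))

      window : ∀ {t u} → t < u → u ≤ L + n → σ₁ t ≡ σ₁ u → L + t ≤ u
      window {t} {u} t<u u≤ eq with split t | split u
      ... | early t<L | early u<L =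
        contradiction (block-injective (σ₁-block t<L) (subst (Block u) (sym eq) (σ₁-block u<L))) (<⇒≢ t<u)
      ... | late t | early u<L = contradiction (<-trans t<u u<L) (m+n≮m L t)
      ... | late t | late u = +-monoʳ-≤ L
        (P.window (+-cancelˡ-< L t u t<u) (+-cancelˡ-≤ L u n u≤)
                  (trans (sym (σ₁-shift t)) (trans eq (σ₁-shift u))))
      ... | early t<L | late u with u <? L
      ...   | yes u<L = +-monoʳ-≤ L (block-first (σ₁-block t<L)
                (subst (Near A u) (sym (trans eq (σ₁-shift u))) (P.left u<L)))
      ...   | no u≮L = +-monoʳ-≤ L (≤-trans (<⇒≤ t<L) (≮⇒≥ u≮L))

  -- Blocks are stripped until the length is at least `L` and below `L + L`, the range of the
  -- four-letter word.
  pattern-exists : ∀ {n} → L ≤ n → Pattern n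
  pattern-exists L≤n = go L≤n (<-wellFounded _)
    where
    go : ∀ {n} → L ≤ n → Acc _<_ n → Pattern n
    go {n} L≤n (acc rec) with n <? L + L
    ... | yes n<2L = shortPattern L≤n n<2L
    ... | no n≮2L = subst Pattern (m+[n∸m]≡n L≤n)
      (longPattern L≤n∸L (go L≤n∸L (rec (∸-monoʳ-< (s≤s z≤n) L≤n))))
      where
      L≤n∸L : L ≤ n ∸ L
      L≤n∸L = m+n≤o⇒m≤o∸n L (≮⇒≥ n≮2L)

-- Hues of darts

fresh : ∀ {n} (xs : List (Fin n)) → length xs < n → ∃ λ i → ¬ (i List.∈ xs)
fresh {n} xs len with Fin.any? (λ i → ¬? (DecMembership._∈?_ Fin._≟_ i xs))
... | yes found = found
... | no none = contradiction (Setoid.index-injective (setoid _) (all∈ i) (all∈ j) eq) (Fin.<⇒≢ i<j)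
  where
  all∈ : ∀ i → i List.∈ xs
  all∈ i = decidable-stable (DecMembership._∈?_ Fin._≟_ i xs) (λ i∉ → none (i , i∉))
  clash : ∃₂ λ i j → i Fin.< j × index (all∈ i) ≡ index (all∈ j)
  clash = Fin.pigeonhole len (index ∘ all∈)
  i = proj₁ clash
  j = proj₁ (proj₂ clash)
  i<j = proj₁ (proj₂ (proj₂ clash))
  eq = proj₂ (proj₂ (proj₂ clash))

transpose-view : ∀ {n} (i j k : Fin n) →
  (k ≡ i × transpose i j k ≡ j) ⊎ (k ≡ j × transpose i j k ≡ i) ⊎ (k ≢ i × transpose i j k ≡ k)
transpose-view i j k with k Fin.≟ i
... | yes k≡i = inj₁ (k≡i , refl)
... | no k≢i with k Fin.≟ j
...   | yes k≡j = inj₂ (inj₁ (k≡j , refl))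
...   | no _ = inj₂ (inj₂ (k≢i , refl))

transpose-left : ∀ {n} (i j : Fin n) → transpose i j i ≡ j
transpose-left i j with i Fin.≟ i
... | yes _ = refl
... | no i≢i = contradiction refl i≢i

transpose-injective : ∀ {n} (i j : Fin n) {k l} → transpose i j k ≡ transpose i j l → k ≡ l
transpose-injective i j eq =
  trans (sym (transpose-inverse j i)) (trans (cong (transpose j i) eq) (transpose-inverse j i))

module _ {n : ℕ} {R : Fin n → Fin n → Set} (R? : ∀ x y → Dec (R x y)) (u : Fin n) where

  -- `origin` asks for a predecessor inside `S`, not for a walk from `u`; the exchange argument
  -- consults only this last step.
  record Reachable (S : Subset n) : Set where
    field
      root   : u ∈ S
      closed : ∀ {x y} → x ∈ S → R x y → y ∈ S
      origin : ∀ {y} → y ∈ S → y ≡ u ⊎ ∃ λ x → x ∈ S × R x y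

  -- Successors are added to the singleton of `u` until none is left; each addition strictly
  -- enlarges the subset, so the recursion is well founded.
  reachable : ∃ Reachable
  reachable = saturate ⁅ u ⁆ (⊃-wellFounded _) (x∈⁅x⁆ u) (inj₁ ∘ x∈⁅y⁆⇒x≡y u)
    where
    saturate : ∀ S → Acc _⊃_ S → u ∈ S → (∀ {y} → y ∈ S → y ≡ u ⊎ ∃ λ x → x ∈ S × R x y) → ∃ Reachable
    saturate S (acc rec) root origin
      with Fin.any? (λ x → Fin.any? (λ y → (x ∈? S) ×-dec ¬? (y ∈? S) ×-dec R? x y))
    ... | no none = S , record
      { root = root
      ; closed = λ {x} {y} x∈S xRy → decidable-stable (y ∈? S) (λ y∉S → none (x , y , x∈S , y∉S , xRy))
      ; origin = origin }
    ... | yes (x , y , x∈S , y∉S , xRy) = saturate (S ∪ ⁅ y ⁆)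
      (rec (grow , y , q⊆p∪q S ⁅ y ⁆ (x∈⁅x⁆ y) , y∉S))
      (grow root) origin′
      where
      grow : ∀ {z} → z ∈ S → z ∈ S ∪ ⁅ y ⁆
      grow = p⊆p∪q ⁅ y ⁆
      origin′ : ∀ {z} → z ∈ S ∪ ⁅ y ⁆ → z ≡ u ⊎ ∃ λ x → x ∈ S ∪ ⁅ y ⁆ × R x z
      origin′ z∈ with x∈p∪q⁻ S ⁅ y ⁆ z∈
      ... | inj₂ z∈y rewrite x∈⁅y⁆⇒x≡y y z∈y = inj₂ (x , grow x∈S , xRy)
      ... | inj₁ z∈S with origin z∈S
      ...   | inj₁ z≡u = inj₁ z≡u
      ...   | inj₂ (w , w∈S , wRz) = inj₂ (w , grow w∈S , wRz)

-- With darts viewed as half-edges, this is a proper edge colouring of the graph in which every edge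
-- is cut in two. That graph is bipartite, so König's theorem explains why `Δ` hues suffice. The
-- relation `E` is a parameter because edges enter one at a time.
record DartColouring {V : Set} (E : V → V → Set) (Δ : ℕ) : Set where
  field
    colour   : V → V → Fin Δ
    proper   : ∀ {u w w′} → E u w → E u w′ → w ≢ w′ → colour u w ≢ colour u w′
    opposite : ∀ {u w} → E u w → colour u w ≢ colour w u

restrict : ∀ {V : Set} {E F : V → V → Set} {Δ} → (∀ {x y} → F x y → E x y) →
           DartColouring E Δ → DartColouring F Δ
restrict F⊆E K = record
  { colour = colour ; proper = λ e f → proper (F⊆E e) (F⊆E f) ; opposite = opposite ∘ F⊆E }
  where open DartColouring K

Missing : ∀ {V : Set} {E : V → V → Set} {Δ} → DartColouring E Δ → V → Fin Δ → Set
Missing {E = E} K u α = ∀ {x} → E u x → DartColouring.colour K u x ≢ α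

WithEdge : ∀ {V : Set} → (V → V → Set) → V → V → V → V → Set
WithEdge E u v x y = E x y ⊎ (x ≡ u × y ≡ v) ⊎ (x ≡ v × y ≡ u)

module _ {N Δ : ℕ} {E : Fin N → Fin N → Set} (E? : ∀ x y → Dec (E x y))
         (E-sym : ∀ {x y} → E x y → E y x) where

  -- Follow edges xy from u with (x , y) coloured γ and (y , x) coloured α. Every vertex after u on this
  -- chain carries an α-dart, so v is not among them, and α and γ can be exchanged at all its vertices.
  exchange : (K : DartColouring E Δ) {u v : Fin N} (α γ : Fin Δ) → u ≢ v →
             Missing K u α → Missing K v α →
             Σ (DartColouring E Δ) λ K′ → Missing K′ u γ × Missing K′ v α
  exchange K {u} {v} α γ u≢v mu mv = K′ , mu′ , mv′
    where
    open DartColouring K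
    R : Fin N → Fin N → Set
    R x y = E x y × colour x y ≡ γ × colour y x ≡ α
    R? : ∀ x y → Dec (R x y)
    R? x y = E? x y ×-dec (colour x y Fin.≟ γ) ×-dec (colour y x Fin.≟ α)
    S : Subset N
    S = proj₁ (reachable R? u)
    open Reachable (proj₂ (reachable R? u))
    τ : Fin Δ → Fin Δ
    τ = transpose α γ

    v∉S : v ∉ S
    v∉S v∈S with origin v∈S
    ... | inj₁ v≡u = u≢v (sym v≡u)
    ... | inj₂ (_ , _ , e , _ , eq) = mv (E-sym e) eq

    -- By `proper` the `α`-dart at `x` is unique, so the predecessor given by `origin` is `y`; and
    -- `u` has no `α`-dart.
    back-closed : ∀ {x y} → x ∈ S → R y x → y ∈ S
    back-closed {x} {y} x∈S (e , _ , xy≡α) with origin x∈S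
    ... | inj₁ refl = contradiction xy≡α (mu (E-sym e))
    ... | inj₂ (w , w∈S , f , _ , xw≡α) with w Fin.≟ y
    ...   | yes refl = w∈S
    ...   | no w≢y = contradiction (trans xw≡α (sym xy≡α)) (proper (E-sym f) (E-sym e) w≢y)

    colour′ : Fin N → Fin N → Fin Δ
    colour′ x y with x ∈? S
    ... | yes _ = τ (colour x y)
    ... | no _ = colour x y

    -- Only the dart at `x` is recoloured. A new clash needs one dart of the edge in `α` and the
    -- other in `γ`, and then the chain passes along this edge and contains `y`.
    boundary : ∀ {x y} → x ∈ S → y ∉ S → E x y → τ (colour x y) ≢ colour y x
    boundary {x} {y} x∈S y∉S e eq with transpose-view α γ (colour x y)
    ... | inj₁ (xy≡α , τ≡γ) = y∉S (back-closed x∈S (E-sym e , trans (sym eq) τ≡γ , xy≡α))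
    ... | inj₂ (inj₁ (xy≡γ , τ≡α)) = y∉S (closed x∈S (e , xy≡γ , trans (sym eq) τ≡α))
    ... | inj₂ (inj₂ (_ , τ≡xy)) = opposite e (trans (sym τ≡xy) eq)

    K′ : DartColouring E Δ
    K′ = record { colour = colour′ ; proper = proper′ ; opposite = opposite′ }
      where
      proper′ : ∀ {x y z} → E x y → E x z → y ≢ z → colour′ x y ≢ colour′ x z
      proper′ {x} e f y≢z with x ∈? S
      ... | yes _ = proper e f y≢z ∘ transpose-injective α γ
      ... | no _ = proper e f y≢z
      opposite′ : ∀ {x y} → E x y → colour′ x y ≢ colour′ y x
      opposite′ {x} {y} e with x ∈? S | y ∈? S
      ... | yes _ | yes _ = opposite e ∘ transpose-injective α γ
      ... | yes x∈S | no y∉S = boundary x∈S y∉S e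
      ... | no x∉S | yes y∈S = boundary y∈S x∉S (E-sym e) ∘ sym
      ... | no _ | no _ = opposite e

    mu′ : Missing K′ u γ
    mu′ {x} e eq with u ∈? S
    ... | no u∉S = u∉S root
    ... | yes _ = mu e (transpose-injective α γ (trans eq (sym (transpose-left α γ))))

    mv′ : Missing K′ v α
    mv′ e with v ∈? S
    ... | yes v∈S = contradiction v∈S v∉S
    ... | no _ = mv e

  -- If the missing hues agree, an exchange with any other hue `γ` makes `γ` missing at `u` and
  -- leaves `α` missing at `v`.
  separate : 2 ≤ Δ → (K : DartColouring E Δ) {u v : Fin N} → u ≢ v →
             ∃ (Missing K u) → ∃ (Missing K v) →
             Σ (DartColouring E Δ) λ K′ → ∃₂ λ α β → α ≢ β × Missing K′ u α × Missing K′ v β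
  separate 2≤Δ K u≢v (α , mu) (β , mv) with α Fin.≟ β
  ... | no α≢β = K , α , β , α≢β , mu , mv
  ... | yes refl with γ , γ∉ ← fresh (α ∷ []) 2≤Δ with K′ , mu′ , mv′ ← exchange K α γ u≢v mu mv =
    K′ , γ , α , (λ γ≡α → γ∉ (here γ≡α)) , mu′ , mv′

  insert : (K : DartColouring E Δ) {u v : Fin N} {α β : Fin Δ} → u ≢ v → ¬ E u v → α ≢ β →
           Missing K u α → Missing K v β → DartColouring (WithEdge E u v) Δ
  insert K {u} {v} {α} {β} u≢v ¬uv α≢β mu mv = record
    { colour = colour′ ; proper = proper′ ; opposite = opposite′ }
    where
    open DartColouring K
    colour′ : Fin N → Fin N → Fin Δ
    colour′ x y with (x Fin.≟ u) ×-dec (y Fin.≟ v) | (x Fin.≟ v) ×-dec (y Fin.≟ u)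
    ... | yes _ | _ = α
    ... | no _ | yes _ = β
    ... | no _ | no _ = colour x y

    at-u : colour′ u v ≡ α
    at-u with (u Fin.≟ u) ×-dec (v Fin.≟ v)
    ... | yes _ = refl
    ... | no ¬p = contradiction (refl , refl) ¬p

    at-v : colour′ v u ≡ β
    at-v with (v Fin.≟ u) ×-dec (u Fin.≟ v) | (v Fin.≟ v) ×-dec (u Fin.≟ u)
    ... | yes (v≡u , _) | _ = contradiction (sym v≡u) u≢v
    ... | no _ | yes _ = refl
    ... | no _ | no ¬p = contradiction (refl , refl) ¬p

    old : ∀ {x y} → E x y → colour′ x y ≡ colour x y
    old {x} {y} e with (x Fin.≟ u) ×-dec (y Fin.≟ v) | (x Fin.≟ v) ×-dec (y Fin.≟ u)
    ... | yes (refl , refl) | _ = contradiction e ¬uv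
    ... | no _ | yes (refl , refl) = contradiction (E-sym e) ¬uv
    ... | no _ | no _ = refl

    proper′ : ∀ {x y z} → WithEdge E u v x y → WithEdge E u v x z → y ≢ z → colour′ x y ≢ colour′ x z
    proper′ (inj₁ e) (inj₁ f) y≢z eq = proper e f y≢z (trans (sym (old e)) (trans eq (old f)))
    proper′ (inj₁ e) (inj₂ (inj₁ (refl , refl))) _ eq = mu e (trans (sym (old e)) (trans eq at-u))
    proper′ (inj₁ e) (inj₂ (inj₂ (refl , refl))) _ eq = mv e (trans (sym (old e)) (trans eq at-v))
    proper′ (inj₂ (inj₁ (refl , refl))) (inj₁ f) _ eq = mu f (trans (sym (old f)) (trans (sym eq) at-u))
    proper′ (inj₂ (inj₂ (refl , refl))) (inj₁ f) _ eq = mv f (trans (sym (old f)) (trans (sym eq) at-v))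
    proper′ (inj₂ (inj₁ (refl , refl))) (inj₂ (inj₁ (_ , refl))) y≢z _ = y≢z refl
    proper′ (inj₂ (inj₁ (refl , refl))) (inj₂ (inj₂ (u≡v , _))) _ _ = u≢v u≡v
    proper′ (inj₂ (inj₂ (refl , refl))) (inj₂ (inj₁ (v≡u , _))) _ _ = u≢v (sym v≡u)
    proper′ (inj₂ (inj₂ (refl , refl))) (inj₂ (inj₂ (_ , refl))) y≢z _ = y≢z refl

    opposite′ : ∀ {x y} → WithEdge E u v x y → colour′ x y ≢ colour′ y x
    opposite′ (inj₁ e) eq = opposite e (trans (sym (old e)) (trans eq (old (E-sym e))))
    opposite′ (inj₂ (inj₁ (refl , refl))) eq = α≢β (trans (sym at-u) (trans eq at-v))
    opposite′ (inj₂ (inj₂ (refl , refl))) eq = α≢β (trans (sym at-u) (trans (sym eq) at-v))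

-- Degrees, and colouring the darts edge by edge

sum-indicator : ∀ {A : Set} (f : A → Bool) xs →
  sum (map (λ x → if f x then 1 else 0) xs) ≡ length (filter (λ x → f x Bool.≟ true) xs)
sum-indicator f [] = refl
sum-indicator f (x ∷ xs) with f x
... | true = cong suc (sum-indicator f xs)
... | false = sum-indicator f xs

foldr-⊔-upper : ∀ {x} xs → x List.∈ xs → x ≤ foldr _⊔_ 0 xs
foldr-⊔-upper (x ∷ xs) (here refl) = m≤m⊔n x _
foldr-⊔-upper (x ∷ xs) (there x∈) = ≤-trans (foldr-⊔-upper xs x∈) (m≤n⊔m x _)

module _ (G : FinGraph) where
  open FinGraph G renaming (sym to adj-sym; irrefl to adj-irrefl)

  Adj-sym : ∀ {u v} → Adj G u v → Adj G v u
  Adj-sym {u} {v} e = trans (adj-sym v u) e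

  Adj⇒≢ : ∀ {u v} → Adj G u v → u ≢ v
  Adj⇒≢ {u} e refl with () ← trans (sym e) (adj-irrefl u)

  neighbours : Fin N → List (Fin N)
  neighbours v = filter (λ w → adj v w Bool.≟ true) (allFin N)

  degree≡length : ∀ v → degree G v ≡ length (neighbours v)
  degree≡length v = sum-indicator (adj v) (allFin N)

  degree≤maxDegree : ∀ v → degree G v ≤ maxDegree G
  degree≤maxDegree v = foldr-⊔-upper _ (∈-map⁺ (degree G) (∈-allFin v))

  maxDegree-attained : 1 ≤ maxDegree G → ∃ λ v → degree G v ≡ maxDegree G
  maxDegree-attained 1≤Δ with foldr-selective ⊔-sel 0 (map (degree G) (allFin N))
  ... | inj₁ Δ≡0 with () ← subst (1 ≤_) Δ≡0 1≤Δ
  ... | inj₂ Δ∈ with v , _ , eq ← ∈-map⁻ (degree G) Δ∈ = v , sym eq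

  module _ {Δ : ℕ} (2≤Δ : 2 ≤ Δ) (deg≤Δ : ∀ v → degree G v ≤ Δ) where

    -- The edges entered so far, in either orientation. Listed pairs that are not edges are ignored,
    -- so the final list can be the full product.
    Listed : List (Fin N × Fin N) → Fin N → Fin N → Set
    Listed ps x y = Adj G x y × ((x , y) List.∈ ps ⊎ (y , x) List.∈ ps)

    Listed? : ∀ ps x y → Dec (Listed ps x y)
    Listed? ps x y = (adj x y Bool.≟ true) ×-dec (((x , y) ∈L? ps) ⊎-dec ((y , x) ∈L? ps))
      where open DecMembership (≡-dec (Fin._≟_ {N}) (Fin._≟_ {N})) renaming (_∈?_ to _∈L?_)

    Listed-sym : ∀ ps {x y} → Listed ps x y → Listed ps y x
    Listed-sym ps (e , inj₁ p) = Adj-sym e , inj₂ p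
    Listed-sym ps (e , inj₂ p) = Adj-sym e , inj₁ p

    -- The dart from `u` to `v` has no hue yet, so fewer than `degree G u` hues occur at `u`.
    missing : ∀ ps (K : DartColouring (Listed ps) Δ) {u v} → Adj G u v → ¬ Listed ps u v → ∃ (Missing K u)
    missing ps K {u} {v} e ¬uv =
      proj₁ free , λ {x} f eq → proj₂ free (subst (List._∈ map (colour u) used) eq
        (∈-map⁺ (colour u) (∈-filter⁺ (Listed? ps u) (∈-filter⁺ (λ w → adj u w Bool.≟ true) (∈-allFin x) (proj₁ f)) f)))
      where
      open DartColouring K
      used : List (Fin N)
      used = filter (Listed? ps u) (neighbours u)
      short : length (map (colour u) used) < Δ
      short = <-≤-trans
        (subst (_< length (neighbours u)) (sym (length-map (colour u) used))
          (filter-notAll (Listed? ps u) (neighbours u)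
            (Any.map (λ { refl → ¬uv }) (∈-filter⁺ (λ w → adj u w Bool.≟ true) (∈-allFin v) e))))
        (≤-trans (≤-reflexive (sym (degree≡length u))) (deg≤Δ u))
      free : ∃ λ α → ¬ (α List.∈ map (colour u) used)
      free = fresh (map (colour u) used) short

    -- A pair that is no edge, or is already listed in some orientation, changes nothing. A new edge
    -- has a missing hue at each end, and these are made distinct before it is inserted.
    colour-listed : ∀ ps → DartColouring (Listed ps) Δ
    colour-listed [] = record
      { colour = λ _ _ → Fin.fromℕ< 2≤Δ
      ; proper = λ { (_ , inj₁ ()) ; (_ , inj₂ ()) }
      ; opposite = λ { (_ , inj₁ ()) ; (_ , inj₂ ()) } }
    colour-listed ((u , v) ∷ ps) with K ← colour-listed ps | adj u v Bool.≟ true | Listed? ps u v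
    ... | no ¬e | _ = restrict sub K
      where
      sub : ∀ {x y} → Listed ((u , v) ∷ ps) x y → Listed ps x y
      sub (e , inj₁ (here refl)) = contradiction e ¬e
      sub (e , inj₁ (there p)) = e , inj₁ p
      sub (e , inj₂ (here refl)) = contradiction (Adj-sym e) ¬e
      sub (e , inj₂ (there p)) = e , inj₂ p
    ... | yes _ | yes uv = restrict sub K
      where
      sub : ∀ {x y} → Listed ((u , v) ∷ ps) x y → Listed ps x y
      sub (e , inj₁ (here refl)) = uv
      sub (e , inj₁ (there p)) = e , inj₁ p
      sub (e , inj₂ (here refl)) = Listed-sym ps uv
      sub (e , inj₂ (there p)) = e , inj₂ p
    ... | yes e | no ¬uv
      with K′ , α , β , α≢β , mu , mv ← separate (Listed? ps) (Listed-sym ps) 2≤Δ K (Adj⇒≢ e)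
             (missing ps K e ¬uv) (missing ps K (Adj-sym e) (¬uv ∘ Listed-sym ps)) =
      restrict sub (insert (Listed? ps) (Listed-sym ps) K′ (Adj⇒≢ e) ¬uv α≢β mu mv)
      where
      sub : ∀ {x y} → Listed ((u , v) ∷ ps) x y → WithEdge (Listed ps) u v x y
      sub (e , inj₁ (here refl)) = inj₂ (inj₁ (refl , refl))
      sub (e , inj₁ (there p)) = inj₁ (e , inj₁ p)
      sub (e , inj₂ (here refl)) = inj₂ (inj₂ (refl , refl))
      sub (e , inj₂ (there p)) = inj₁ (e , inj₂ p)

    dartColouring : DartColouring (Adj G) Δ
    dartColouring = restrict {E = Listed (cartesianProduct (allFin N) (allFin N))}
      (λ {x} {y} e → e , inj₁ (∈-cartesianProduct⁺ (∈-allFin x) (∈-allFin y)))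
      (colour-listed (cartesianProduct (allFin N) (allFin N)))

-- Walks in the subdivision

module _ {V : Set} {R : V → V → Set} where

  _++ʷ_ : ∀ {x y z i j} → Walk R x y i → Walk R y z j → Walk R x z (i + j)
  nil ++ʷ q = q
  cons e p ++ʷ q = cons e (p ++ʷ q)

  reverseʷ : (∀ {x y} → R x y → R y x) → ∀ {x y i} → Walk R x y i → Walk R y x i
  reverseʷ R-sym nil = nil
  reverseʷ R-sym (cons {ℓ = i} e p) =
    subst (Walk R _ _) (+-comm i 1) (reverseʷ R-sym p ++ʷ cons (R-sym e) nil)

  -- A colouring is injective on a clique. Applied to a clique and a colouring of equal size, this
  -- bounds the chromatic number below and the clique number above.
  clique≤colours : ∀ {i j} → HasClique R i → Colourable R j → i ≤ j
  clique≤colours {i} {j} (f , f-clique) (c , c-proper) with i ≤? j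
  ... | yes i≤j = i≤j
  ... | no i≰j with a , b , a<b , eq ← Fin.pigeonhole (≰⇒> i≰j) (c ∘ f) =
    contradiction eq (c-proper _ _ (f-clique a b (Fin.<⇒≢ a<b)))

module Subdivision (G : FinGraph) (n : ℕ) (0<n : 0 < n) where
  open FinGraph G using (N)

  -- x lies on the path replacing the edge uw, at distance t from u and s from w.
  data Loc : SubV G n → Fin N → Fin N → ℕ → ℕ → Set where
    start : ∀ {u w s} → Adj G u w → s ≡ n → Loc (inj₁ u) u w 0 s
    stop  : ∀ {u w t} → Adj G u w → t ≡ n → Loc (inj₁ w) u w t 0
    fwd   : ∀ {u w lt a t s 0<t<n} → t + s ≡ n → Loc (inj₂ ((u , w , lt , a) , t , 0<t<n)) u w t s
    bwd   : ∀ {u w lt a t s 0<t<n} → t + s ≡ n → Loc (inj₂ ((u , w , lt , a) , t , 0<t<n)) w u s t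

  Adj-irrelevant : ∀ {u w} (a a′ : Adj G u w) → a ≡ a′
  Adj-irrelevant = Decidable⇒UIP.≡-irrelevant Bool._≟_

  flip : ∀ {x u w t s} → Loc x u w t s → Loc x w u s t
  flip (start a e) = stop (Adj-sym G a) e
  flip (stop a e) = start (Adj-sym G a) e
  flip (fwd e) = bwd e
  flip (bwd e) = fwd e

  Loc-adj : ∀ {x u w t s} → Loc x u w t s → Adj G u w
  Loc-adj (start a _) = a
  Loc-adj (stop a _) = a
  Loc-adj (fwd {a = a} _) = a
  Loc-adj (bwd {a = a} _) = Adj-sym G a

  Loc-sum : ∀ {x u w t s} → Loc x u w t s → t + s ≡ n
  Loc-sum (start _ e) = e
  Loc-sum (stop _ e) = trans (+-identityʳ _) e
  Loc-sum (fwd e) = e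
  Loc-sum (bwd {t = t} {s} e) = trans (+-comm s t) e

  -- Inner vertices carry proofs of order, adjacency and bounds, all irrelevant. Mixed cases clash:
  -- positions 0 and `n` are not inner, and an edge is stored in one orientation only.
  Loc-unique : ∀ {x y u w t s} → Loc x u w t s → Loc y u w t s → x ≡ y
  Loc-unique (start _ _) (start _ _) = refl
  Loc-unique (start _ refl) (stop _ refl) = contradiction 0<n (n≮n 0)
  Loc-unique (start _ refl) (fwd {0<t<n = () , _} _)
  Loc-unique (start _ refl) (bwd {0<t<n = _ , t<n} _) = contradiction t<n (n≮n _)
  Loc-unique (stop _ refl) (start _ refl) = contradiction 0<n (n≮n 0)
  Loc-unique (stop _ _) (stop _ _) = refl
  Loc-unique (stop _ refl) (fwd {0<t<n = _ , t<n} _) = contradiction t<n (n≮n _)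
  Loc-unique (stop _ refl) (bwd {0<t<n = () , _} _)
  Loc-unique (fwd {0<t<n = () , _} _) (start _ refl)
  Loc-unique (fwd {0<t<n = _ , t<n} _) (stop _ refl) = contradiction t<n (n≮n _)
  Loc-unique (fwd {lt = l} {a} {0<t<n = p , q} _) (fwd {lt = l′} {a′} {0<t<n = p′ , q′} _)
    rewrite Fin.<-irrelevant l l′ | Adj-irrelevant a a′ | ≤-irrelevant p p′ | ≤-irrelevant q q′ = refl
  Loc-unique (fwd {lt = l} _) (bwd {lt = l′} _) = contradiction l′ (Fin.<-asym l)
  Loc-unique (bwd {0<t<n = _ , t<n} _) (start _ refl) = contradiction t<n (n≮n _)
  Loc-unique (bwd {0<t<n = () , _} _) (stop _ refl)
  Loc-unique (bwd {lt = l} _) (fwd {lt = l′} _) = contradiction l′ (Fin.<-asym l)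
  Loc-unique (bwd {lt = l} {a} {0<t<n = p , q} _) (bwd {lt = l′} {a′} {0<t<n = p′ , q′} _)
    rewrite Fin.<-irrelevant l l′ | Adj-irrelevant a a′ | ≤-irrelevant p p′ | ≤-irrelevant q q′ = refl

  at-Loc : (e : Edge G) → ∀ {t s} → t + s ≡ n → Loc (at G n e t) (proj₁ e) (proj₁ (proj₂ e)) t s
  at-Loc (u , w , lt , a) {zero} e = start a e
  at-Loc (u , w , lt , a) {suc t} {s} e with suc t <? n
  ... | yes t<n = fwd e
  ... | no t≮n with s
  ...   | zero = stop a (trans (sym (+-identityʳ _)) e)
  ...   | suc s = contradiction (subst (suc t <_) e (m<m+n (suc t) (s≤s z≤n))) t≮n

  Loc-exists : ∀ {u w t s} → Adj G u w → t + s ≡ n → ∃ λ x → Loc x u w t s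
  Loc-exists {u} {w} {t} {s} a e with Fin.<-cmp u w
  ... | tri< u<w _ _ = _ , at-Loc (u , w , u<w , a) e
  ... | tri≈ _ u≡w _ = contradiction u≡w (Adj⇒≢ G a)
  ... | tri> _ _ w<u = _ , flip (at-Loc (w , u , w<u , Adj-sym G a) (trans (+-comm s t) e))

  SubAdj-sym : ∀ {x y} → SubAdj G n x y → SubAdj G n y x
  SubAdj-sym (e , j , j<n , inj₁ p) = e , j , j<n , inj₂ p
  SubAdj-sym (e , j , j<n , inj₂ p) = e , j , j<n , inj₁ p

  -- The edge is oriented along the step, so every step leads away from `u`.
  SubAdj⇒Loc : ∀ {x y} → SubAdj G n x y → ∃₂ λ u w → ∃₂ λ t s → Loc x u w t (suc s) × Loc y u w (suc t) s
  SubAdj⇒Loc (e , j , j<n , p) with s , f ← m≤n⇒∃[o]m+o≡n j<n | p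
  ... | inj₁ (refl , refl) = _ , _ , j , s , at-Loc e (trans (+-suc j s) f) , at-Loc e f
  ... | inj₂ (refl , refl) = _ , _ , s , j , flip (at-Loc e f) , flip (at-Loc e (trans (+-suc j s) f))

  Loc⇒SubAdj : ∀ {x y u w t s} → Loc x u w t (suc s) → Loc y u w (suc t) s → SubAdj G n x y
  Loc⇒SubAdj {u = u} {w} {t} {s} p q with Fin.<-cmp u w
  ... | tri< u<w _ _ = (u , w , u<w , Loc-adj p) , t , m+n≤o⇒m≤o (suc t) (≤-reflexive (Loc-sum q)) ,
    inj₁ (Loc-unique p (at-Loc _ (Loc-sum p)) , Loc-unique q (at-Loc _ (Loc-sum q)))
  ... | tri≈ _ u≡w _ = contradiction u≡w (Adj⇒≢ G (Loc-adj p))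
  ... | tri> _ _ w<u =
    (w , u , w<u , Loc-adj (flip p)) , s , m+n≤o⇒m≤o (suc s) (≤-reflexive (Loc-sum (flip p))) ,
    inj₂ (Loc-unique (flip q) (at-Loc _ (Loc-sum (flip q))) , Loc-unique (flip p) (at-Loc _ (Loc-sum (flip p))))

  walk-to-end : ∀ {x u w t s} → Loc x u w t s → Walk (SubAdj G n) x (inj₁ u) t
  walk-to-end {t = zero} p with refl ← Loc-unique p (start (Loc-adj p) (Loc-sum p)) = nil
  walk-to-end {t = suc t} {s} p with y , q ← Loc-exists (Loc-adj p) (trans (+-suc t s) (Loc-sum p)) =
    cons (SubAdj-sym (Loc⇒SubAdj q p)) (walk-to-end q)

  -- The two shapes left for a walk of length at most `n`: within one path, with positions at most
  -- `ℓ` apart, or via an original vertex `u`, with distances to `u` adding to at most `ℓ`. In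
  -- `through` the two paths may be the same.
  data Close (x y : SubV G n) (ℓ : ℕ) : Set where
    along   : ∀ {u w t s t′ s′} → Loc x u w t s → Loc y u w t′ s′ → t′ ≤ ℓ + t → t ≤ ℓ + t′ → Close x y ℓ
    through : ∀ {u w w′ t s t′ s′} → Loc x u w t s → Loc y u w′ t′ s′ → t + t′ ≤ ℓ → Close x y ℓ

  -- The coordinates one vertex can have: an inner vertex has two, one per orientation, while an
  -- original vertex is an end of every path at it.
  data Coincide : (u w : Fin N) (t s : ℕ) (u′ w′ : Fin N) (t′ s′ : ℕ) → Set where
    equal    : ∀ {u w t s} → Coincide u w t s u w t s
    reversed : ∀ {u w t s} → Coincide u w t s w u s t
    meet     : ∀ {u w w′ t s t′ s′} → s ≡ 0 → t′ ≡ 0 → Coincide u w t s w w′ t′ s′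
    meet′    : ∀ {u w u′ t s t′ s′} → s ≡ 0 → s′ ≡ 0 → Coincide u w t s u′ w t′ s′

  coincide : ∀ {x u w t s u′ w′ t′ s′} → Loc x u w (suc t) s → Loc x u′ w′ t′ s′ →
             Coincide u w (suc t) s u′ w′ t′ s′
  coincide (stop _ _) (start _ _) = meet refl refl
  coincide (stop _ _) (stop _ _) = meet′ refl refl
  coincide (fwd {t = t} e) (fwd f) with refl ← +-cancelˡ-≡ t _ _ (trans e (sym f)) = equal
  coincide (fwd {t = t} e) (bwd f) with refl ← +-cancelˡ-≡ t _ _ (trans e (sym f)) = reversed
  coincide (bwd {t = t} e) (fwd f) with refl ← +-cancelˡ-≡ t _ _ (trans e (sym f)) = reversed
  coincide (bwd {t = t} e) (bwd f) with refl ← +-cancelˡ-≡ t _ _ (trans e (sym f)) = equal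

  close-step : ∀ {x y z ℓ} → SubAdj G n x y → Close y z ℓ → ℓ < n → Close x z (suc ℓ)
  close-step {ℓ = ℓ} xy (along {t = t₁} {t′ = t′} {s′} y z t′≤ t≤) ℓ<n
    with u , w , t , s , p , q ← SubAdj⇒Loc xy with coincide q y
  ... | equal = along p z (≤-trans t′≤ (≤-reflexive (+-suc ℓ t))) (≤-trans (n≤1+n _) (m≤n⇒m≤1+n t≤))
  ... | reversed = along (flip p) z (≤-trans t′≤ (m≤n⇒m≤1+n (+-monoʳ-≤ ℓ (n≤1+n s)))) (s≤s t≤)
  ... | meet refl refl = through (flip p) z (s≤s (≤-trans t′≤ (≤-reflexive (+-identityʳ ℓ))))
  ... | meet′ refl refl = through (flip p) (flip z) (s≤s (+-cancelʳ-≤ t′ s′ ℓ (begin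
    s′ + t′ ≡⟨ +-comm s′ t′ ⟩
    t′ + s′ ≡⟨ trans (Loc-sum z) (sym (Loc-sum y)) ⟩
    t₁ + 0  ≡⟨ +-identityʳ t₁ ⟩
    t₁      ≤⟨ t≤ ⟩
    ℓ + t′  ∎)))
    where open ≤-Reasoning
  close-step xy (through {t = t₁} y z ≤ℓ) ℓ<n
    with u , w , t , s , p , q ← SubAdj⇒Loc xy with coincide q y
  ... | equal = through p z (≤-trans (n≤1+n _) (m≤n⇒m≤1+n ≤ℓ))
  ... | reversed = through (flip p) z (s≤s ≤ℓ)
  ... | meet refl refl = through (flip p) z (s≤s ≤ℓ)
  -- Here `y` is an original vertex at distance `n` from the turning point, farther than `ℓ < n`
  -- permits.
  ... | meet′ refl refl = contradiction
    (≤-trans (≤-reflexive (trans (sym (Loc-sum y)) (+-identityʳ t₁))) (m+n≤o⇒m≤o t₁ ≤ℓ)) (<⇒≱ ℓ<n)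

  walk⇒close : ∀ {x y z ℓ} → SubAdj G n x y → Walk (SubAdj G n) y z ℓ → ℓ < n → Close x z (suc ℓ)
  walk⇒close xy nil _ with u , w , t , s , p , q ← SubAdj⇒Loc xy = along p q ≤-refl (m≤n⇒m≤1+n (n≤1+n t))
  walk⇒close xy (cons yz p) ℓ<n = close-step xy (walk⇒close yz p (<-trans (n<1+n _) ℓ<n)) ℓ<n

-- The colouring of the subdivision and the clique

relabel : ∀ {X Y : Set} → (X → Y) → Symbol X → Symbol Y
relabel f = Maybe.map (Product.map₁ f)

relabel-injective : ∀ {X Y : Set} {f : X → Y} → (∀ {x y} → f x ≡ f y → x ≡ y) →
                    ∀ x y → relabel f x ≡ relabel f y → x ≡ y
relabel-injective f-inj nothing nothing _ = refl
relabel-injective f-inj (just (a , i)) (just (b , j)) eq with just-injective eq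
... | eq′ with refl ← f-inj (cong proj₁ eq′) | refl ← cong proj₂ eq′ = refl

-- `C` and `D` receive hues not yet taken; the choice for `D` avoids three hues and so uses `4 ≤ Δ`.
palette : ∀ {Δ} → 4 ≤ Δ → (a b : Fin Δ) → a ≢ b →
          Σ (Letter → Fin Δ) λ ι → (∀ {x y} → ι x ≡ ι y → x ≡ y) × ι A ≡ a × ι B ≡ b
palette 4≤Δ a b a≢b
  with c , c∉ ← fresh (a ∷ b ∷ []) (<-≤-trans (n<1+n 2) (<⇒≤ 4≤Δ))
  with d , d∉ ← fresh (a ∷ b ∷ c ∷ []) 4≤Δ = ι , injective , refl , refl
  where
  ι : Letter → Fin _
  ι A = a
  ι B = b
  ι C = c
  ι D = d
  injective : ∀ {x y} → ι x ≡ ι y → x ≡ y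
  injective {A} {A} _ = refl
  injective {B} {B} _ = refl
  injective {C} {C} _ = refl
  injective {D} {D} _ = refl
  injective {A} {B} e = contradiction e a≢b
  injective {B} {A} e = contradiction (sym e) a≢b
  injective {A} {C} e = contradiction (here (sym e)) c∉
  injective {C} {A} e = contradiction (here e) c∉
  injective {B} {C} e = contradiction (there (here (sym e))) c∉
  injective {C} {B} e = contradiction (there (here e)) c∉
  injective {A} {D} e = contradiction (here (sym e)) d∉
  injective {D} {A} e = contradiction (here e) d∉
  injective {B} {D} e = contradiction (there (here (sym e))) d∉
  injective {D} {B} e = contradiction (there (here e)) d∉
  injective {C} {D} e = contradiction (there (there (here (sym e)))) d∉
  injective {D} {C} e = contradiction (there (there (here e))) d∉

module _ (k : ℕ) where
  open Word k

  Near-relabel : ∀ {X Y : Set} (f : X → Y) {a p x} → Near a p x → Near (f a) p (relabel f x)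
  Near-relabel f end = end
  Near-relabel f (near p q) = near p q
  Near-relabel f (far p q) = far p q

  Valid-relabel : ∀ {X Y : Set} (f : X → Y) {x} → Valid x → Valid (relabel f x)
  Valid-relabel f blank = blank
  Valid-relabel f (level p q) = level p q

  Near-zero : ∀ {X : Set} {a : X} {x} → Near a 0 x → x ≡ nothing
  Near-zero end = refl

  Near-value : ∀ {X : Set} {a : X} {p x} → Near a p x → 1 ≤ p → p ≤ k → x ≡ just (a , p)
  Near-value (near _ _) _ _ = refl
  Near-value (far k<p _) _ p≤k = contradiction p≤k (<⇒≱ k<p)

  -- Two `near` symbols differ in hue, a `near` and a `far` one force `p + q` to be at least `L`,
  -- and two `far` ones have both distances above `k`. Only blanks remain.
  Near-disjoint : ∀ {X : Set} {a b : X} {p q x} → Near a p x → Near b q x → a ≢ b → p + q < L →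
                  p ≡ 0 × q ≡ 0
  Near-disjoint end end _ _ = refl , refl
  Near-disjoint (near _ _) (near _ _) a≢b _ = contradiction refl a≢b
  Near-disjoint {p = p} {q} (near _ _) (far _ L≤) _ <L =
    contradiction (≤-trans L≤ (≤-reflexive (+-comm q p))) (<⇒≱ <L)
  Near-disjoint (far _ L≤) (near _ _) _ <L = contradiction L≤ (<⇒≱ <L)
  Near-disjoint (far k<p _) (far k<q _) _ <L =
    contradiction <L (≤⇒≯ (+-mono-≤ k<p (<⇒≤ k<q)))

  encode : ∀ {Δ} {x : Symbol (Fin Δ)} → Valid x → Fin (suc (Δ * k))
  encode blank = zero
  encode (level {a} {suc i} _ i<k) = suc (Fin.combine a (Fin.fromℕ< i<k))

  encode-injective : ∀ {Δ} {x y : Symbol (Fin Δ)} (v : Valid x) (w : Valid y) → encode v ≡ encode w → x ≡ y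
  encode-injective blank blank _ = refl
  encode-injective blank (level {i = suc _} _ _) ()
  encode-injective (level {i = suc _} _ _) blank ()
  encode-injective (level {a} {suc i} _ p) (level {b} {suc j} _ q) eq
    with refl , eq′ ← Fin.combine-injective a _ b _ (Fin.suc-injective eq)
    with refl ← Fin.fromℕ<-injective i j p q eq′ = refl

  module _ (G : FinGraph) {n : ℕ} (L≤n : L ≤ n) {Δ : ℕ} (4≤Δ : 4 ≤ Δ)
           (K : DartColouring (Adj G) Δ) where
    open FinGraph G using (N)
    open Subdivision G n (≤-trans (s≤s z≤n) L≤n)
    open DartColouring K
    open Pattern (pattern-exists L≤n)

    paint : ∀ {u w} → Adj G u w → Letter → Fin Δ
    paint a = proj₁ (palette 4≤Δ _ _ (opposite a))

    paint-injective : ∀ {u w} (a : Adj G u w) {x y} → paint a x ≡ paint a y → x ≡ y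
    paint-injective a = proj₁ (proj₂ (palette 4≤Δ _ _ (opposite a)))

    paint-A : ∀ {u w} (a : Adj G u w) → paint a A ≡ colour u w
    paint-A a = proj₁ (proj₂ (proj₂ (palette 4≤Δ _ _ (opposite a))))

    paint-B : ∀ {u w} (a : Adj G u w) → paint a B ≡ colour w u
    paint-B a = proj₂ (proj₂ (proj₂ (palette 4≤Δ _ _ (opposite a))))

    -- The pattern is read from the end of the edge that is stored first: `A` becomes the hue of the
    -- dart there, `B` that of the opposite dart.
    φ : SubV G n → Symbol (Fin Δ)
    φ (inj₁ v) = nothing
    φ (inj₂ ((_ , _ , _ , a) , j , _)) = relabel (paint a) (σ j)

    φ-valid : ∀ x → Valid (φ x)
    φ-valid (inj₁ v) = blank
    φ-valid (inj₂ ((_ , _ , _ , a) , j , _ , j<n)) =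
      Valid-relabel (paint a) (valid (proj₂ (m≤n⇒∃[o]m+o≡n (<⇒≤ j<n))))

    -- `left` serves the end stored first and `right` the other, so the outcome no longer depends on
    -- the stored orientation.
    φ-near : ∀ {x u w t s} → Loc x u w t s → t < L → Near (colour u w) t (φ x)
    φ-near (start _ _) _ = end
    φ-near (stop _ refl) t<L = contradiction t<L (≤⇒≯ L≤n)
    φ-near (fwd {a = a} {t} _) t<L =
      subst (λ c → Near c t (relabel (paint a) (σ t))) (paint-A a) (Near-relabel (paint a) (left t<L))
    φ-near (bwd {a = a} {t} {s} e) s<L =
      subst (λ c → Near c s (relabel (paint a) (σ t))) (paint-B a) (Near-relabel (paint a) (right {t} e s<L))

    φ-along : ∀ {x u w t s} → u Fin.< w → (a : Adj G u w) → Loc x u w t s → φ x ≡ relabel (paint a) (σ t)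
    φ-along u<w a (start _ _) = cong (relabel (paint a)) (sym (Near-zero (left (s≤s z≤n))))
    φ-along u<w a (stop _ refl) =
      cong (relabel (paint a)) (sym (Near-zero (right {s = 0} (+-identityʳ n) (s≤s z≤n))))
    φ-along u<w a (fwd {a = a′} {t} _) = cong (λ a → relabel (paint a) (σ t)) (Adj-irrelevant a′ a)
    φ-along u<w a (bwd {lt = w<u} _) = contradiction w<u (Fin.<-asym u<w)

    -- Measured from the other end, the two inequalities of `along` trade places; this reduces
    -- `along-distinct` to `u < w`.
    mirror : ∀ {t s t′ s′} ℓ → t + s ≡ n → t′ + s′ ≡ n → t′ ≤ ℓ + t → s ≤ ℓ + s′
    mirror {t} {s} {t′} {s′} ℓ e e′ t′≤ = +-cancelˡ-≤ t s (ℓ + s′) (begin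
      t + s          ≡⟨ trans e (sym e′) ⟩
      t′ + s′        ≤⟨ +-monoˡ-≤ s′ t′≤ ⟩
      (ℓ + t) + s′   ≡⟨ cong (_+ s′) (+-comm ℓ t) ⟩
      (t + ℓ) + s′   ≡⟨ +-assoc t ℓ s′ ⟩
      t + (ℓ + s′)   ∎)
      where open ≤-Reasoning

    along-distinct-< : ∀ {x y u w t s t′ s′} → u Fin.< w → Loc x u w t s → Loc y u w t′ s′ →
                       t′ ≤ k + k + t → t ≤ k + k + t′ → x ≢ y → φ x ≢ φ y
    along-distinct-< {t = t} {t′ = t′} u<w p q t′≤ t≤ x≢y eq
      with a ← Loc-adj p
      with σ≡ ← relabel-injective (paint-injective a) (σ t) (σ t′)
             (trans (sym (φ-along u<w a p)) (trans eq (φ-along u<w a q)))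
      with <-cmp t t′
    ... | tri< t<t′ _ _ = <⇒≱ (window t<t′ (m+n≤o⇒m≤o t′ (≤-reflexive (Loc-sum q))) σ≡) t′≤
    ... | tri> _ _ t′<t = <⇒≱ (window t′<t (m+n≤o⇒m≤o t (≤-reflexive (Loc-sum p))) (sym σ≡)) t≤
    ... | tri≈ _ refl _ with refl ← +-cancelˡ-≡ t _ _ (trans (Loc-sum p) (sym (Loc-sum q))) = x≢y (Loc-unique p q)

    along-distinct : ∀ {x y u w t s t′ s′} → Loc x u w t s → Loc y u w t′ s′ →
                     t′ ≤ k + k + t → t ≤ k + k + t′ → x ≢ y → φ x ≢ φ y
    along-distinct {u = u} {w} {t} {s} {t′} {s′} p q t′≤ t≤ with Fin.<-cmp u w
    ... | tri< u<w _ _ = along-distinct-< u<w p q t′≤ t≤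
    ... | tri≈ _ u≡w _ = contradiction u≡w (Adj⇒≢ G (Loc-adj p))
    ... | tri> _ _ w<u = along-distinct-< w<u (flip p) (flip q)
      (mirror {t′} {s′} {t} {s} (k + k) (Loc-sum q) (Loc-sum p) t≤)
      (mirror {t} {s} {t′} {s′} (k + k) (Loc-sum p) (Loc-sum q) t′≤)

    through-distinct : ∀ {x y u w w′ t s t′ s′} → Loc x u w t s → Loc y u w′ t′ s′ →
                       t + t′ ≤ k + k → x ≢ y → φ x ≢ φ y
    through-distinct {w = w} {w′} {t} {t′ = t′} p q t+t′≤ x≢y eq with w Fin.≟ w′
    -- Both arms of the walk lie on one path, where the distances differ by at most their sum.
    ... | yes refl = along-distinct p q
      (≤-trans (m+n≤o⇒n≤o t t+t′≤) (m≤m+n _ t)) (≤-trans (m+n≤o⇒m≤o t t+t′≤) (m≤m+n _ t′)) x≢y eq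
    ... | no w≢w′ with Near-disjoint
                         (subst (Near _ t) eq (φ-near p (s≤s (m+n≤o⇒m≤o t t+t′≤))))
                         (φ-near q (s≤s (m+n≤o⇒n≤o t t+t′≤)))
                         (proper (Loc-adj p) (Loc-adj q) w≢w′) (s≤s t+t′≤)
    ...   | refl , refl = x≢y (trans (Loc-unique p (start (Loc-adj p) (Loc-sum p)))
                                     (sym (Loc-unique q (start (Loc-adj q) (Loc-sum q)))))

    φ-proper : ∀ {x y} → FracPowAdj G (k + k) n x y → φ x ≢ φ y
    φ-proper (x≢y , _ , _ , nil) = contradiction refl x≢y
    φ-proper (x≢y , _ , ℓ≤ , cons e p) with walk⇒close e p (≤-trans ℓ≤ (<⇒≤ L≤n))
    ... | along {t = t} {t′ = t′} a b t′≤ t≤ =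
      along-distinct a b (≤-trans t′≤ (+-monoˡ-≤ t ℓ≤)) (≤-trans t≤ (+-monoˡ-≤ t′ ℓ≤)) x≢y
    ... | through a b ≤ℓ = through-distinct a b (≤-trans ≤ℓ ℓ≤) x≢y

    colourable : Colourable (FracPowAdj G (k + k) n) (suc (Δ * k))
    colourable = (λ x → encode (φ-valid x)) ,
      λ x y xy → φ-proper xy ∘ encode-injective (φ-valid x) (φ-valid y)

    -- The points of the ball are told apart by their colours φ.
    ball : ∀ {v} (nbr : Fin Δ → Fin N) → (∀ a → Adj G v (nbr a)) → (∀ {a b} → nbr a ≡ nbr b → a ≡ b) →
           HasClique (FracPowAdj G (k + k) n) (suc (Δ * k))
    ball {v} nbr nbr-adj nbr-injective = point , clique
      where
      k≤n : k ≤ n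
      k≤n = ≤-trans (m≤m+n k k) (<⇒≤ L≤n)

      spoke : (a : Fin Δ) (i : Fin k) → ∃₂ λ x s → Loc x v (nbr a) (suc (Fin.toℕ i)) s
      spoke a i with s , e ← m≤n⇒∃[o]m+o≡n (≤-trans (Fin.toℕ<n i) k≤n) with x , p ← Loc-exists (nbr-adj a) e =
        x , s , p

      point : Fin (suc (Δ * k)) → SubV G n
      point zero = inj₁ v
      point (suc c) = let a , i = Fin.remQuot k c in proj₁ (spoke a i)

      radius : ∀ c → ∃ λ t → t ≤ k × Walk (SubAdj G n) (point c) (inj₁ v) t
      radius zero = 0 , z≤n , nil
      radius (suc c) = let a , i = Fin.remQuot k c in
        suc (Fin.toℕ i) , Fin.toℕ<n i , walk-to-end (proj₂ (proj₂ (spoke a i)))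

      φ-spoke : ∀ a i → φ (proj₁ (spoke a i)) ≡ just (colour v (nbr a) , suc (Fin.toℕ i))
      φ-spoke a i = Near-value (φ-near (proj₂ (proj₂ (spoke a i))) (s≤s (≤-trans (Fin.toℕ<n i) (m≤m+n k k))))
        (s≤s z≤n) (Fin.toℕ<n i)

      -- By `proper` the hue names the spoke, and the level names the distance from `v`.
      spoke-injective : ∀ {a b i j} → φ (proj₁ (spoke a i)) ≡ φ (proj₁ (spoke b j)) → a ≡ b × i ≡ j
      spoke-injective {a} {b} {i} {j} eq with just-injective (trans (sym (φ-spoke a i)) (trans eq (φ-spoke b j)))
      ... | eq′ =
        nbr-injective (decidable-stable (nbr a Fin.≟ nbr b) λ a≢b → proper (nbr-adj a) (nbr-adj b) a≢b (cong proj₁ eq′)) ,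
        Fin.toℕ-injective (suc-injective (cong proj₂ eq′))

      φ-point-injective : ∀ c d → φ (point c) ≡ φ (point d) → c ≡ d
      φ-point-injective zero zero _ = refl
      φ-point-injective zero (suc d) eq with () ← trans eq (let a , i = Fin.remQuot k d in φ-spoke a i)
      φ-point-injective (suc c) zero eq with () ← trans (sym eq) (let a , i = Fin.remQuot k c in φ-spoke a i)
      φ-point-injective (suc c) (suc d) eq with e , f ← spoke-injective eq = cong suc (begin
        c                                           ≡⟨ Fin.combine-remQuot {Δ} k c ⟨
        Product.uncurry Fin.combine (Fin.remQuot {Δ} k c) ≡⟨ cong₂ Fin.combine e f ⟩
        Product.uncurry Fin.combine (Fin.remQuot {Δ} k d) ≡⟨ Fin.combine-remQuot {Δ} k d ⟩
        d                                           ∎)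
        where open ≡-Reasoning

      clique : ∀ c d → c ≢ d → FracPowAdj G (k + k) n (point c) (point d)
      clique c d c≢d with i , i≤k , p ← radius c | j , j≤k , q ← radius d =
        (λ eq → c≢d (φ-point-injective c d (cong φ eq))) , i + j , +-mono-≤ i≤k j≤k ,
        (p ++ʷ reverseʷ SubAdj-sym q)

-- Equality of the chromatic and clique numbers

lookup-injective : ∀ {X : Set} {xs : List X} → Unique xs → ∀ {i j} → lookup xs i ≡ lookup xs j → i ≡ j
lookup-injective (x∉ ∷ xs!) {zero} {zero} _ = refl
lookup-injective (x∉ ∷ xs!) {zero} {suc j} eq = contradiction eq (All.lookup x∉ (∈-lookup j))
lookup-injective (x∉ ∷ xs!) {suc i} {zero} eq = contradiction (sym eq) (All.lookup x∉ (∈-lookup i))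
lookup-injective (x∉ ∷ xs!) {suc i} {suc j} eq = cong suc (lookup-injective xs! eq)

theorem3p1 : (m n : ℕ) → 1 ≤ m → m < n → 2 ∣ m →
    (G : FinGraph) → Connected G → 4 ≤ maxDegree G →
    Σ ℕ (λ k → IsChromaticNumber (FracPowAdj G m n) k × IsCliqueNumber (FracPowAdj G m n) k)
theorem3p1 _ n _ m<n (divides k refl) G _ 4≤Δ
  with v , deg≡Δ ← maxDegree-attained G (≤-trans (s≤s z≤n) 4≤Δ)
  -- Turns `k * 2` into `k + k`, so that `m<n` becomes the bound `L ≤ n`.
  rewrite *-comm k 2 | +-identityʳ k =
  suc (maxDegree G * k) ,
  (colours , λ j j< c → <⇒≱ j< (clique≤colours clique c)) ,
  (clique , λ j j> f → <⇒≱ j> (clique≤colours f colours))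
  where
  K : DartColouring (Adj G) (maxDegree G)
  K = dartColouring G (≤-trans (s≤s (s≤s z≤n)) 4≤Δ) (degree≤maxDegree G)

  colours : Colourable (FracPowAdj G (k + k) n) (suc (maxDegree G * k))
  colours = colourable k G m<n 4≤Δ K

  -- The size is a variable so that the star can be transported from the length of the neighbour
  -- list to the maximum degree.
  Star : ℕ → Set
  Star Δ = Σ (Fin Δ → Fin (FinGraph.N G)) λ nbr →
    (∀ a → Adj G v (nbr a)) × (∀ {a b} → nbr a ≡ nbr b → a ≡ b)

  star : Star (length (neighbours G v))
  star = lookup (neighbours G v) ,
    (λ a → proj₂ (∈-filter⁻ (λ w → FinGraph.adj G v w Bool.≟ true) {xs = allFin _} (∈-lookup a))) ,
    lookup-injective (Unique.filter⁺ _ (Unique.allFin⁺ _))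

  clique : HasClique (FracPowAdj G (k + k) n) (suc (maxDegree G * k))
  clique with nbr , adj , inj ← subst Star (trans (sym (degree≡length G v)) deg≡Δ) star =
    ball k G m<n 4≤Δ K nbr adj inj
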